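{- The OB unboundedness and OB termination problems are decidable for FIFO machines. That is, given a FIFO machine $M=(Q,\mathit{Ch},\Sigma,\Delta,q_0)$ and a tuple $(L_c)_{c\in\mathit{Ch}}$ of non-empty regular bounded languages $L_c\subseteq\Sigma_c^\ast$, it is decidable (i) whether $\mathrm{Reach}_M(\mathrm{Pref}(L_?))$ is infinite, and (ii) whether there is no infinite execution $s_0\xrightarrow{\beta_1}s_1\xrightarrow{\beta_2}s_2\cdots$ from the initial configuration $s_0$ with $\beta_i\in A_M$ and $\beta_1\cdots\beta_i\in\mathrm{Pref}(L_?)$ for all $i$.
   Context: A bounded language over non-empty words $(w_1,\ldots,w_n)$ is a language $L\subseteq w_1^\ast\cdots w_n^\ast$. A FIFO machine is $M=(Q,\mathit{Ch},\Sigma,\Delta,q_0)$ with finite control states $Q$, initial state $q_0$, finite channels $\mathit{Ch}$, alphabet $\Sigma=\biguplus_c\Sigma_c$, and $\Delta\subseteq Q\times A_M\times Q$, $A_M=\{c!a,c?a\mid c\in\mathit{Ch},a\in\Sigma_c\}$. Configurations $(q,\mathbf{w})$ with $\mathbf{w}\in\prod_c\Sigma_c^\ast$; initial $(q_0,(\varepsilon)_c)$. A send $c!a$ appends $a$ to channel $c$; a receive $c?a$ removes $a$ from the head of channel $c$ (only possible if $a$ is at the head); other channels unchanged; the control state moves along a transition of $\Delta$. $\mathrm{Reach}_M(L)$ is the set of configurations reachable from the initial one via a label word in $L\subseteq A_M^\ast$. $L_?=\{\sigma\in A_M^\ast\mid\mathrm{proj}_{c?}(\sigma)\in L_c\ \forall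 c\}$, where $\mathrm{proj}_{c?}$ keeps the messages of receive actions on $c$ and erases all other actions. $\mathrm{Pref}(L)$ is the set of prefixes of words in $L$. -}

module Defs where

open import Data.Fin using (Fin; _≟_)
open import Data.Fin.Subset using (Subset) renaming (_∈_ to _∈ₛ_)
open import Data.List using (List; []; _∷_; _++_; _∷ʳ_; concat; replicate; foldl; mapMaybe; applyUpTo)
open import Data.List.Membership.Propositional using (_∈_)
open import Data.List.Relation.Unary.All using (All)
open import Data.List.Relation.Unary.Any using (Any)
open import Data.Maybe using (Maybe; just; nothing)
open import Data.Nat using (ℕ; suc)
open import Data.Product using (Σ; ∃; _×_; _,_)
open import Level using (0ℓ)
open import Relation.Binary using (Rel)
open import Relation.Binary.PropositionalEquality using (_≡_; _≢_; refl)
open import Relation.Nullary using (¬_; yes; no)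
open import Relation.Unary using (Pred; _⊆_; _≐_)

Language : Set → Set₁
Language A = Pred (List A) 0ℓ

Pref : ∀ {A} → Language A → Language A
Pref L u = ∃ λ v → L (u ++ v)

record DFA (A : Set) : Set where
  field
    size  : ℕ
    start : Fin size
    step  : Fin size → A → Fin size
    final : Subset size

  Accepts : Language A
  Accepts u = foldl step start u ∈ₛ final

Regular : ∀ {A} → Language A → Set
Regular {A} L = Σ (DFA A) λ D → L ≐ DFA.Accepts D

-- StarProduct (w₁ ∷ … ∷ wₙ ∷ []) is the language w₁* ⋯ wₙ*.
StarProduct : ∀ {A} → List (List A) → Language A
StarProduct []       u = u ≡ []
StarProduct (w ∷ ws) u =
  ∃ λ k → ∃ λ v → StarProduct ws v × u ≡ concat (replicate k w) ++ v

Bounded : ∀ {A} → Language A → Set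
Bounded L = ∃ λ ws → All (_≢ []) ws × L ⊆ StarProduct ws

-- Channels are Fin k, and Σ_c is Fin (m c): the alphabet is the disjoint union
-- of the Σ_c, so a letter always comes together with its channel.
data Action {k : ℕ} (m : Fin k → ℕ) : Set where
  _!_ : (c : Fin k) → Fin (m c) → Action m
  _⁇_ : (c : Fin k) → Fin (m c) → Action m

record FIFOMachine : Set where
  field
    #states   : ℕ
    #channels : ℕ
    #letters  : Fin #channels → ℕ

  State : Set
  State = Fin #states

  Channel : Set
  Channel = Fin #channels

  Letter : Channel → Set
  Letter c = Fin (#letters c)

  Act : Set
  Act = Action #letters

  field
    Δ  : List (State × Act × State)
    q₀ : State

module _ (M : FIFOMachine) where
  open FIFOMachine M

  Config : Set
  Config = State × (∀ c → List (Letter c))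

  -- Channel contents are functions, so configurations are identified when their
  -- contents agree pointwise (_≡_ would be too fine without extensionality).
  _≈_ : Rel Config 0ℓ
  (q , w) ≈ (q′ , w′) = q ≡ q′ × (∀ c → w c ≡ w′ c)

  initial : Config
  initial = q₀ , λ _ → []

  data Step : Config → Act → Config → Set where
    send : ∀ {q q′ w w′ c a} →
           (q , c ! a , q′) ∈ Δ →
           w′ c ≡ w c ∷ʳ a →
           (∀ d → d ≢ c → w′ d ≡ w d) →
           Step (q , w) (c ! a) (q′ , w′)
    recv : ∀ {q q′ w w′ c a} →
           (q , c ⁇ a , q′) ∈ Δ →
           w c ≡ a ∷ w′ c →
           (∀ d → d ≢ c → w′ d ≡ w d) →
           Step (q , w) (c ⁇ a) (q′ , w′)

  data Run : Config → List Act → Config → Set where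
    []  : ∀ {s} → Run s [] s
    _∷_ : ∀ {s t u β σ} → Step s β t → Run t σ u → Run s (β ∷ σ) u

  Reach : Language Act → Pred Config 0ℓ
  Reach L s = ∃ λ σ → L σ × Run initial σ s

  received : (c : Channel) → Act → Maybe (Letter c)
  received c (d ! a) = nothing
  received c (d ⁇ a) with d ≟ c
  ... | yes refl = just a
  ... | no  _    = nothing

  proj⁇ : (c : Channel) → List Act → List (Letter c)
  proj⁇ c = mapMaybe (received c)

  -- The language L_? of a tuple (L_c).
  OutputLanguage : (∀ c → Language (Letter c)) → Language Act
  OutputLanguage L σ = ∀ c → L c (proj⁇ c σ)

  Finite : Pred Config 0ℓ → Set
  Finite P = ∃ λ ss → ∀ s → P s → Any (s ≈_) ss

  Infinite : Pred Config 0ℓ → Set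
  Infinite P = ¬ Finite P

  record InfiniteExecution (L : Language Act) : Set where
    field
      config  : ℕ → Config
      label   : ℕ → Act
      starts  : config 0 ≡ initial
      steps   : ∀ i → Step (config i) (label i) (config (suc i))
      -- applyUpTo label i is the word of the first i labels.
      allowed : ∀ i → L (applyUpTo label i)

  OBUnbounded : (∀ c → Language (Letter c)) → Set
  OBUnbounded L = Infinite (Reach (Pref (OutputLanguage L)))

  OBTerminating : (∀ c → Language (Letter c)) → Set
  OBTerminating L = ¬ InfiniteExecution (Pref (OutputLanguage L))

{-# OPTIONS --safe #-}
-- Only the received words are restricted, and every σ ∈ Pref(L_?) keeps the DFA of L_c in a live
-- state on each channel c. Since L_c is bounded, any two loops at an accessible live state commute.
-- Suppose a run goes from (q , u) to (q , u′) by a nonempty word which sends x on a channel and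
-- brings the DFA back to its state. If u′ = u z and z x = x z on every channel, the word can be
-- performed again from (q , u′), ends in (q , u′ z), and so on for ever; the contents grow as soon
-- as some z is nonempty. By a constructive Ramsey argument (almost-full relations) every long
-- enough run contains such a pair of configurations, so the tree of all runs is either finite or
-- contains an infinite execution. For unboundedness one explores the runs without repetition:
-- either some pair has z nonempty or the reachable configurations are exhausted.
module Submission where

open import Defs
open import Data.Empty using (⊥)
open import Data.Fin using (Fin; zero; suc; _≟_; toℕ; opposite)
open import Data.Fin.Properties using (toℕ-injective; toℕ<n; opposite-prop)
  renaming (all? to allFin?; any? to anyFin?)
open import Data.Fin.Subset using () renaming (_∈_ to _∈ₛ_)
open import Data.Fin.Subset.Properties using () renaming (_∈?_ to _∈ₛ?_)
open import Data.List using (List; []; _∷_; _++_; _∷ʳ_; concat; replicate; foldl; length; map; mapMaybe; drop; filter; allFin; applyUpTo)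
open import Data.List.Membership.Propositional using (_∈_; find; lose)
open import Data.List.Membership.Propositional.Properties using (∈-filter⁺; ∈-filter⁻; ∈-map⁺; ∈-map⁻; ∈-++⁺ˡ; ∈-++⁺ʳ; ∈-++⁻; ∈-allFin)
open import Data.List.Properties using (++-assoc; ++-identityʳ; ++-conicalˡ; ++-conicalʳ; ++-monoid; ∷-injective; ∷-injectiveʳ; length-++; length-++-comm; length-++-≤ˡ; foldl-++; ≡-dec; mapMaybe-++; mapMaybe-map-retract; mapMaybe-map-none; applyUpTo-∷ʳ)
open import Data.List.Relation.Unary.All using (All)
import Data.List.Relation.Unary.All as All
import Data.List.Relation.Unary.All.Properties as All
open import Data.List.Relation.Unary.Any using (Any; here; there; any?)
open import Data.Maybe using (Maybe; just; nothing)
open import Data.Nat using (ℕ; zero; suc; _+_; _*_; _∸_; _≤_; _<_; z≤n; s≤s; s≤s⁻¹; s<s; NonZero; >-nonZero)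
open import Data.Nat.Divisibility using (divides)
open import Data.Nat.ListAction using (product)
open import Data.Nat.ListAction.Properties using (∈⇒∣product; product≢0)
open import Data.Nat.Properties using (≤-trans; ≤-reflexive; ≤-antisym; ≤-total; <-≤-connex; ≮⇒≥; <⇒≱; <⇒≢; *-cancelʳ-≤; *-assoc; *-comm; +-comm; +-cancelʳ-≤; +-mono-≤; +-monoˡ-≤; m≤m*n; m≤m+n; m≤n+m; m<m+n; m+[n∸m]≡n; m≤n⇒m∸n≡0; m<n⇒0<n∸m; ∸-monoʳ-<; module ≤-Reasoning)
open import Data.Product using (∃; _×_; _,_; proj₁; proj₂)
open import Data.Sum using (_⊎_; inj₁; inj₂; [_,_]′; map₁; map₂)
open import Function using (flip; _on_; _∘_; id)
open import Induction.WellFounded using (Acc; acc)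
open import Level using (0ℓ)
open import Relation.Binary using (Rel; _⇒_; Reflexive; Transitive; Decidable)
open import Relation.Binary.Construct.Closure.ReflexiveTransitive using (Star; ε; _◅_; _◅◅_)
open import Relation.Binary.PropositionalEquality
open import Relation.Nullary using (¬_; ¬?; Dec; yes; no; contradiction; _×-dec_; decidable-stable)
open import Relation.Nullary.Decidable using (map′)
open import Relation.Unary using (Satisfiable; _≐_)
open import Tactic.MonoidSolver using (solve)

private variable
  A B : Set
  R S : Rel A 0ℓ

-- Almost-full relations

-- What remains to be met once `a` has been played: a later entry that `a` is related to makes every
-- pair starting with it count.
_after_ : Rel A 0ℓ → A → Rel A 0ℓ
(R after a) x y = R x y ⊎ R a x

-- Coquand's inductive form of "every infinite sequence has indices i < j with R xᵢ xⱼ".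
data AlmostFull {A : Set} (R : Rel A 0ℓ) : Set₁ where
  now   : (∀ x y → R x y) → AlmostFull R
  later : (∀ a → AlmostFull (R after a)) → AlmostFull R

af-mono : R ⇒ S → AlmostFull R → AlmostFull S
af-mono R⇒S (now total)  = now λ x y → R⇒S (total x y)
af-mono R⇒S (later next) = later λ a →
  af-mono [ inj₁ ∘ R⇒S , inj₂ ∘ R⇒S ]′ (next a)

af-on : (f : B → A) → AlmostFull R → AlmostFull (R on f)
af-on f (now total)  = now λ x y → total (f x) (f y)
af-on f (later next) = later λ b → af-on f (next (f b))

after-mono : ∀ {a} → R ⇒ S → R after a ⇒ S after a
after-mono R⇒S (inj₁ r) = inj₁ (R⇒S r)
after-mono R⇒S (inj₂ r) = inj₂ (R⇒S r)

-- R only has to become almost full once an S-related pair has been played.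
af-bind : AlmostFull S → (∀ a b → S a b → AlmostFull ((R after a) after b)) → AlmostFull R
af-bind (now total)  rest = later λ a → later λ b → rest a b (total a b)
af-bind {R = R} (later next) rest = later λ a → af-bind (next a) λ where
  b c (inj₁ Sbc) → af-mono
    (after-mono {R = R after b} {S = (R after a) after b} (after-mono {R = R} inj₁))
    (rest b c Sbc)
  b c (inj₂ Sab) → af-mono inj₁ (rest a b Sab)

module _ {A : Set} where

  -- Three intuitionistic Ramsey steps, for predicates P and Q of arity 0, 1 and 2.
  af-∩₀ : ∀ {R C : Rel A 0ℓ} {P Q : Set} → AlmostFull R →
          (∀ {x y} → R x y → C x y ⊎ P) → AlmostFull (λ x y → C x y ⊎ Q) →
          AlmostFull (λ x y → C x y ⊎ P × Q)
  af-∩₀ (now total) R⇒ afQ = flip af-mono afQ λ where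
    (inj₁ c) → inj₁ c
    {x} {y} (inj₂ q) → map₂ (_, q) (R⇒ (total x y))
  af-∩₀ {R} {C} {P} {Q} (later next) R⇒ afQ = later λ a → af-mono
    (λ where
      (inj₁ (inj₁ c)) → inj₁ (inj₁ c)
      (inj₁ (inj₂ c)) → inj₂ (inj₁ c)
      (inj₂ pq)       → inj₁ (inj₂ pq))
    (af-∩₀ {C = C after a} (next a)
      (λ where
        (inj₁ r) → map₁ inj₁ (R⇒ r)
        (inj₂ r) → map₁ inj₂ (R⇒ r))
      (af-mono (map₁ inj₁) afQ))

  af-∩₁ : ∀ {R S C : Rel A 0ℓ} {P Q : A → Set} → AlmostFull R → AlmostFull S →
          (∀ {x y} → R x y → C x y ⊎ P x) → (∀ {x y} → S x y → C x y ⊎ Q x) →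
          AlmostFull (λ x y → C x y ⊎ P x × Q x)
  af-∩₁ {P = P} {Q} (now total) afS R⇒ S⇒ = af-mono
    (λ {x} {y} s → [ inj₁ , (λ q → map₂ (_, q) (R⇒ (total x y))) ]′ (S⇒ s)) afS
  af-∩₁ afR@(later _) (now total) R⇒ S⇒ = af-mono
    (λ {x} {y} r → [ inj₁ , (λ p → map₂ (p ,_) (S⇒ (total x y))) ]′ (R⇒ r)) afR
  -- Once `a` is played, `P a` and `Q a` are mere propositions. Each is added to `C` in turn, so
  -- that the recursion advances in one premise only; `af-∩₀` then joins the two results.
  af-∩₁ {C = C} {P} {Q} afR@(later nextR) afS@(later nextS) R⇒ S⇒ = later λ a →
    af-mono shuffle (af-∩₀ {C = D a} {P = P a} {Q = Q a}
      (af-mono fromP (af-∩₁ {C = λ x y → (C x y ⊎ C a x) ⊎ P a} (nextR a) afS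
        (λ where
          (inj₁ r) → map₁ (inj₁ ∘ inj₁) (R⇒ r)
          (inj₂ r) → inj₁ ([ inj₁ ∘ inj₂ , inj₂ ]′ (R⇒ r)))
        (map₁ (inj₁ ∘ inj₁) ∘ S⇒)))
      id
      (af-mono fromQ (af-∩₁ {C = λ x y → (C x y ⊎ C a x) ⊎ Q a} afR (nextS a)
        (map₁ (inj₁ ∘ inj₁) ∘ R⇒)
        (λ where
          (inj₁ s) → map₁ (inj₁ ∘ inj₁) (S⇒ s)
          (inj₂ s) → inj₁ ([ inj₁ ∘ inj₂ , inj₂ ]′ (S⇒ s))))))
    where
    D : A → Rel A 0ℓ
    D a x y = (C x y ⊎ C a x) ⊎ P x × Q x
    fromP : ∀ {a x y} → ((C x y ⊎ C a x) ⊎ P a) ⊎ P x × Q x → D a x y ⊎ P a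
    fromP (inj₁ (inj₁ c)) = inj₁ (inj₁ c)
    fromP (inj₁ (inj₂ p)) = inj₂ p
    fromP (inj₂ pq)       = inj₁ (inj₂ pq)
    fromQ : ∀ {a x y} → ((C x y ⊎ C a x) ⊎ Q a) ⊎ P x × Q x → D a x y ⊎ Q a
    fromQ (inj₁ (inj₁ c)) = inj₁ (inj₁ c)
    fromQ (inj₁ (inj₂ q)) = inj₂ q
    fromQ (inj₂ pq)       = inj₁ (inj₂ pq)
    shuffle : ∀ {a x y} → D a x y ⊎ P a × Q a →
              (C x y ⊎ P x × Q x) ⊎ (C a x ⊎ P a × Q a)
    shuffle (inj₁ (inj₁ (inj₁ c))) = inj₁ (inj₁ c)
    shuffle (inj₁ (inj₁ (inj₂ c))) = inj₂ (inj₁ c)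
    shuffle (inj₁ (inj₂ pq))       = inj₁ (inj₂ pq)
    shuffle (inj₂ pq)              = inj₂ (inj₂ pq)

  af-∩₂ : ∀ {R S C P Q : Rel A 0ℓ} → AlmostFull R → AlmostFull S →
          (∀ {x y} → R x y → C x y ⊎ P x y) → (∀ {x y} → S x y → C x y ⊎ Q x y) →
          AlmostFull (λ x y → C x y ⊎ P x y × Q x y)
  af-∩₂ (now total) afS R⇒ S⇒ = af-mono
    (λ {x} {y} s → [ inj₁ , (λ q → map₂ (_, q) (R⇒ (total x y))) ]′ (S⇒ s)) afS
  af-∩₂ afR@(later _) (now total) R⇒ S⇒ = af-mono
    (λ {x} {y} r → [ inj₁ , (λ p → map₂ (p ,_) (S⇒ (total x y))) ]′ (R⇒ r)) afR
  -- The same scheme one arity up: here `P a` and `Q a` are unary and are joined by `af-∩₁`.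
  af-∩₂ {C = C} {P} {Q} afR@(later nextR) afS@(later nextS) R⇒ S⇒ = later λ a →
    af-mono shuffle (af-∩₁ {C = D a} {P = P a} {Q = Q a}
      (af-∩₂ {C = λ x y → (C x y ⊎ C a x) ⊎ P a x} (nextR a) afS
        (λ where
          (inj₁ r) → map₁ (inj₁ ∘ inj₁) (R⇒ r)
          (inj₂ r) → inj₁ ([ inj₁ ∘ inj₂ , inj₂ ]′ (R⇒ r)))
        (map₁ (inj₁ ∘ inj₁) ∘ S⇒))
      (af-∩₂ {C = λ x y → (C x y ⊎ C a x) ⊎ Q a x} afR (nextS a)
        (map₁ (inj₁ ∘ inj₁) ∘ R⇒)
        (λ where
          (inj₁ s) → map₁ (inj₁ ∘ inj₁) (S⇒ s)
          (inj₂ s) → inj₁ ([ inj₁ ∘ inj₂ , inj₂ ]′ (S⇒ s))))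
      (from {P}) (from {Q}))
    where
    D : A → Rel A 0ℓ
    D a x y = (C x y ⊎ C a x) ⊎ P x y × Q x y
    from : ∀ {X : Rel A 0ℓ} {a x y} →
           ((C x y ⊎ C a x) ⊎ X a x) ⊎ P x y × Q x y → D a x y ⊎ X a x
    from (inj₁ (inj₁ c)) = inj₁ (inj₁ c)
    from (inj₁ (inj₂ p)) = inj₂ p
    from (inj₂ pq)       = inj₁ (inj₂ pq)
    shuffle : ∀ {a x y} → D a x y ⊎ P a x × Q a x →
              (C x y ⊎ P x y × Q x y) ⊎ (C a x ⊎ P a x × Q a x)
    shuffle (inj₁ (inj₁ (inj₁ c))) = inj₁ (inj₁ c)
    shuffle (inj₁ (inj₁ (inj₂ c))) = inj₂ (inj₁ c)
    shuffle (inj₁ (inj₂ pq))       = inj₁ (inj₂ pq)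
    shuffle (inj₂ pq)              = inj₂ (inj₂ pq)

af-∩ : AlmostFull R → AlmostFull S → AlmostFull (λ x y → R x y × S x y)
af-∩ afR afS = af-mono [ (λ ()) , id ]′
  (af-∩₂ {C = λ _ _ → ⊥} afR afS inj₂ inj₂)

af-∀ : ∀ {n} {R : Fin n → Rel A 0ℓ} → (∀ i → AlmostFull (R i)) →
       AlmostFull (λ x y → ∀ i → R i x y)
af-∀ {n = zero}  af = now λ _ _ ()
af-∀ {n = suc n} af = af-mono
  (λ where (r , rs) zero    → r
           (r , rs) (suc i) → rs i)
  (af-∩ (af zero) (af-∀ (af ∘ suc)))

af-≤ : AlmostFull _≤_
af-≤ = later below
  where
  below : ∀ n → AlmostFull (_≤_ after n)
  below zero    = now λ _ _ → inj₂ z≤n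
  -- The next entry `m` either closes an increasing pair with `suc n`, or is at most `n`; then
  -- `n ≤ x` gives `m ≤ x` and the induction hypothesis serves.
  below (suc n) = later λ m → choose m (<-≤-connex n m)
    where
    choose : ∀ m → n < m ⊎ m ≤ n → AlmostFull ((_≤_ after suc n) after m)
    choose m (inj₁ n<m) = now λ _ _ → inj₂ (inj₂ n<m)
    choose m (inj₂ m≤n) = af-mono
      [ inj₁ ∘ inj₁ , inj₂ ∘ inj₁ ∘ ≤-trans m≤n ]′ (below n)

-- Equality on Fin n is the intersection of ≤ with ≥, and i ↦ opposite i reverses the order.
af-≡ : ∀ {n} → AlmostFull (_≡_ {A = Fin n})
af-≡ = af-mono
  (λ {i} {j} (i≤j , oi≤oj) → toℕ-injective (≤-antisym i≤j (≤-opposite i j oi≤oj)))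
  (af-∩ (af-on toℕ af-≤) (af-on (toℕ ∘ opposite) af-≤))
  where
  ≤-opposite : ∀ {n} (i j : Fin n) → toℕ (opposite i) ≤ toℕ (opposite j) → toℕ j ≤ toℕ i
  ≤-opposite {n} i j p rewrite opposite-prop i | opposite-prop j =
    ≮⇒≥ λ i<j → <⇒≱ (∸-monoʳ-< (s<s i<j) (toℕ<n j)) p

-- Exploration of finitely branching transition systems

module _ {A W : Set} {P : A → Set} where

  ∈-either : (xs : List A) → (∀ {x} → x ∈ xs → W ⊎ P x) → W ⊎ (∀ {x} → x ∈ xs → P x)
  ∈-either []       f = inj₂ λ ()
  ∈-either (x ∷ xs) f with f (here refl) | ∈-either xs (f ∘ there)
  ... | inj₁ w | _       = inj₁ w
  ... | inj₂ p | inj₁ w  = inj₁ w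
  ... | inj₂ p | inj₂ ps = inj₂ λ where
    (here refl)  → p
    (there x∈xs) → ps x∈xs

Edge : (A → List A) → Rel A 0ℓ
Edge succ x y = y ∈ succ x

module _ {A : Set} (succ : A → List A) where
  private _⟶_ = Edge succ

  AllPaths : Rel A 0ℓ → A → Set → Set
  AllPaths T x W = ∀ {a b c} → Star _⟶_ x a → a ⟶ b → Star _⟶_ b c → T a c → W

  -- Induction on almost-fullness: following an edge out of `x` replaces `T` by `T after x`, whose
  -- additional pairs start at `x` itself. When `T` is total, the first edge is already a witness.
  halts-or : ∀ {T W} → AlmostFull T → ∀ x → AllPaths T x W → W ⊎ Acc (flip _⟶_) x
  halts-or (now total) x found = map₂ (λ rs → acc λ {y} → rs {y}) (∈-either (succ x) λ x⟶y →
    inj₁ (found ε x⟶y ε (total _ _)))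
  halts-or (later next) x found = map₂ (λ rs → acc λ {y} → rs {y}) (∈-either (succ x) λ {y} x⟶y →
    halts-or (next x) y λ where
      y⟶*a a⟶b b⟶*c (inj₁ Tac)         → found (x⟶y ◅ y⟶*a) a⟶b b⟶*c Tac
      ε     a⟶b b⟶*c (inj₂ Txa)        → found ε x⟶y ε Txa
      (y⟶z ◅ z⟶*a) a⟶b b⟶*c (inj₂ Txa) → found ε x⟶y (y⟶z ◅ z⟶*a) Txa)

  reachables : ∀ {x} → Acc (flip _⟶_) x →
               ∃ λ ys → ∀ {y} → (y ∈ ys → Star _⟶_ x y) × (Star _⟶_ x y → y ∈ ys)
  reachables {x} (acc rs) =
    let ys , spec = gather (succ x) (λ x⟶y → reachables (rs x⟶y)) in x ∷ ys , λ {y} →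
      (λ where
        (here refl) → ε
        (there y∈)  → let _ , x⟶z , path = proj₁ (spec {y}) y∈ in x⟶z ◅ path) ,
      (λ where
        ε            → here refl
        (x⟶z ◅ path) → there (proj₂ spec x⟶z path))
    where
    gather : ∀ zs →
      (∀ {z} → z ∈ zs → ∃ λ ys → ∀ {y} → (y ∈ ys → Star _⟶_ z y) × (Star _⟶_ z y → y ∈ ys)) →
      ∃ λ ys → ∀ {y} → (y ∈ ys → ∃ λ z → z ∈ zs × Star _⟶_ z y) ×
                       (∀ {z} → z ∈ zs → Star _⟶_ z y → y ∈ ys)
    gather []       f = [] , (λ ()) , λ ()
    gather (z ∷ zs) f =
      let ys , spec = f (here refl) ; ys′ , spec′ = gather zs (f ∘ there) in
      ys ++ ys′ , λ {y} →
        [ (λ y∈ → z , here refl , proj₁ (spec {y}) y∈)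
        , (λ y∈ → let z′ , z′∈ , path = proj₁ (spec′ {y}) y∈ in z′ , there z′∈ , path)
        ]′ ∘ ∈-++⁻ ys ,
        (λ where
          (here refl)  path → ∈-++⁺ˡ (proj₂ spec path)
          (there z∈zs) path → ∈-++⁺ʳ ys (proj₂ spec′ z∈zs path))

-- Paths that never revisit a Same-class, represented by the list of their earlier nodes.
module Avoiding {A : Set} (succ : A → List A) {Same : Rel A 0ℓ}
  (same? : Decidable Same) (same-refl : Reflexive Same) (same-trans : Transitive Same)
  (simulate : ∀ {a b a′} → Same a b → Edge succ a a′ → ∃ λ b′ → Edge succ b b′ × Same a′ b′)
  where
  private
    _⟶_ = Edge succ

    History : Set
    History = List A × A

    visited? : ∀ y (xs : List A) → _
    visited? y xs = any? (same? y) xs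

    extend : History → List History
    extend (h , x) = map (x ∷ h ,_) (filter (λ y → ¬? (visited? y (x ∷ h))) (succ x))

    _⇛_ = Edge extend

    extend⁻ : ∀ {h x k} → (h , x) ⇛ k →
              ∃ λ y → k ≡ (x ∷ h , y) × x ⟶ y × ¬ Any (Same y) (x ∷ h)
    extend⁻ {h} {x} k∈ with y , y∈ , refl ← ∈-map⁻ _ k∈ =
      y , refl , ∈-filter⁻ (λ y → ¬? (visited? y (x ∷ h))) y∈

    forget : ∀ {k l} → Star _⇛_ k l → Star _⟶_ (proj₂ k) (proj₂ l)
    forget ε = ε
    forget (k⇛ ◅ path) with _ , refl , x⟶y , _ ← extend⁻ k⇛ = x⟶y ◅ forget path

    fresh : ∀ {h x k l z} → z ∈ x ∷ h → (h , x) ⇛ k → Star _⇛_ k l → ¬ Same (proj₂ l) z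
    fresh z∈ k⇛ path same with extend⁻ k⇛
    fresh z∈ k⇛ ε same            | _ , refl , _ , new = new (lose z∈ same)
    fresh z∈ k⇛ (l⇛ ◅ path) same  | _ , refl , _ , _   = fresh (there z∈) l⇛ path same

    -- Allows a path to be cut back to a node that it has passed: the initial part up to that node
    -- is again free of repetitions.
    earlier : ∀ {k l z} → Star _⇛_ k l → z ∈ proj₁ l →
              z ∈ proj₁ k ⊎ ∃ λ h → Star _⇛_ k (h , z)
    earlier ε z∈ = inj₁ z∈
    earlier (k⇛ ◅ path) z∈ with _ , refl , _ ← extend⁻ k⇛ | earlier path z∈
    ... | inj₁ (here refl) = inj₂ (_ , ε)
    ... | inj₁ (there z∈h) = inj₁ z∈h
    ... | inj₂ (h , path′) = inj₂ (h , k⇛ ◅ path′)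

    -- A move that would lead to a visited class falls back to the non-repeating path ending in that
    -- class, and `simulate` transfers the remaining moves to its representative.
    cut-cycles : ∀ {r h x a b} → Star _⇛_ ([] , r) (h , x) → Same a x → Star _⟶_ a b →
                 ∃ λ h′ → ∃ λ y → Star _⇛_ ([] , r) (h′ , y) × Same b y
    cut-cycles path same ε = _ , _ , path , same
    cut-cycles {h = h} {x} path same (a⟶a′ ◅ a′⟶*b)
      with x′ , x⟶x′ , same′ ← simulate same a⟶a′ | visited? x′ (x ∷ h)
    ... | no  new = cut-cycles
      (path ◅◅ ∈-map⁺ _ (∈-filter⁺ (λ y → ¬? (visited? y (x ∷ h))) x⟶x′ new) ◅ ε) same′ a′⟶*b
    ... | yes old with find old
    ...   | z , here refl , same″ = cut-cycles path (same-trans same′ same″) a′⟶*b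
    -- The history of the root is empty, which excludes the other case of `earlier`.
    ...   | z , there z∈h , same″ with inj₂ (_ , path′) ← earlier path z∈h =
      cut-cycles path′ (same-trans same′ same″) a′⟶*b

  -- `halts-or` is applied to the system of histories, with `T` read on current nodes. Freshness
  -- then provides `¬ Same c a` for every pair found.
  cover-or : ∀ {T W} → AlmostFull T → ∀ r →
    (∀ {a b c} → Star _⟶_ r a → a ⟶ b → Star _⟶_ b c → T a c → ¬ Same c a → W) →
    W ⊎ ∃ λ ys → (∀ {y} → y ∈ ys → Star _⟶_ r y) ×
                 (∀ {x} → Star _⟶_ r x → ∃ λ y → y ∈ ys × Same x y)
  cover-or {T} {W} af r found = map₂ cover
    (halts-or extend (af-on proj₂ af) ([] , r) λ r⇛*k k⇛l l⇛*m Tkm →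
      found (forget r⇛*k) (edge k⇛l) (forget l⇛*m) Tkm (fresh (here refl) k⇛l l⇛*m))
    where
    edge : ∀ {k l} → k ⇛ l → proj₂ k ⟶ proj₂ l
    edge k⇛ with _ , refl , x⟶y , _ ← extend⁻ k⇛ = x⟶y
    cover : Acc (flip _⇛_) ([] , r) →
            ∃ λ ys → (∀ {y} → y ∈ ys → Star _⟶_ r y) ×
                     (∀ {x} → Star _⟶_ r x → ∃ λ y → y ∈ ys × Same x y)
    cover halts = let ks , spec = reachables extend halts in
      map proj₂ ks ,
      (λ y∈ → let k , k∈ , y≡ = ∈-map⁻ proj₂ y∈ in
              subst (Star _⟶_ r) (sym y≡) (forget (proj₁ (spec {k}) k∈))) ,
      (λ r⟶*x → let _ , y , path , same = cut-cycles ε same-refl r⟶*x in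
                y , ∈-map⁺ proj₂ (proj₂ spec path) , same)

-- Words

module _ {A : Set} where

  levi : ∀ (a : List A) {b} c {d} → a ++ b ≡ c ++ d → length a ≤ length c →
         ∃ λ e → c ≡ a ++ e × b ≡ e ++ d
  levi []       c       eq _  = c , refl , eq
  levi (x ∷ a) (y ∷ c) eq le with refl , eq′ ← ∷-injective eq =
    let e , c≡ , b≡ = levi a c eq′ (s≤s⁻¹ le) in e , cong (x ∷_) c≡ , b≡

  ++-injective : ∀ (a c : List A) {b d} → a ++ b ≡ c ++ d → length a ≡ length c → a ≡ c × b ≡ d
  ++-injective []       []      eq _ = refl , eq
  ++-injective (x ∷ a) (y ∷ c) eq l with refl , eq′ ← ∷-injective eq =
    let a≡c , b≡d = ++-injective a c eq′ (cong (λ n → n ∸ 1) l) in cong (x ∷_) a≡c , b≡d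

  drop-++ : ∀ (u v : List A) → drop (length u) (u ++ v) ≡ v
  drop-++ []      v = refl
  drop-++ (_ ∷ u) v = drop-++ u v

  length-positive : ∀ {w : List A} → w ≢ [] → 0 < length w
  length-positive {[]}    w≢[] = contradiction refl w≢[]
  length-positive {_ ∷ _} _    = s≤s z≤n

  pow : List A → ℕ → List A
  pow w k = concat (replicate k w)

  pow-+ : ∀ w m n → pow w (m + n) ≡ pow w m ++ pow w n
  pow-+ w zero    n = refl
  pow-+ w (suc m) n = trans (cong (w ++_) (pow-+ w m n)) (sym (++-assoc w _ _))

  length-pow : ∀ w k → length (pow w k) ≡ k * length w
  length-pow w zero    = refl
  length-pow w (suc k) = trans (length-++ w) (cong (length w +_) (length-pow w k))

  pow-nonempty : ∀ {w k} .{{_ : NonZero k}} → w ≢ [] → pow w k ≢ []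
  pow-nonempty {w} {suc k} w≢[] eq = w≢[] (++-conicalˡ w _ eq)

  Commute : List A → List A → Set
  Commute x y = x ++ y ≡ y ++ x

  pow-commute : ∀ {x y} k → Commute x y → Commute (pow x k) y
  pow-commute zero    _ = sym (++-identityʳ _)
  pow-commute {x} {y} (suc k) xy = begin
    (x ++ pow x k) ++ y  ≡⟨ ++-assoc x _ y ⟩
    x ++ pow x k ++ y    ≡⟨ cong (x ++_) (pow-commute k xy) ⟩
    x ++ y ++ pow x k    ≡⟨ ++-assoc x y _ ⟨
    (x ++ y) ++ pow x k  ≡⟨ cong (_++ pow x k) xy ⟩
    (y ++ x) ++ pow x k  ≡⟨ ++-assoc y x _ ⟩
    y ++ x ++ pow x k    ∎
    where open ≡-Reasoning

  commute-++ : ∀ {p} x y → Commute p x → Commute p y → Commute p (x ++ y)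
  commute-++ {p} x y px py = begin
    p ++ x ++ y    ≡⟨ ++-assoc p x y ⟨
    (p ++ x) ++ y  ≡⟨ cong (_++ y) px ⟩
    (x ++ p) ++ y  ≡⟨ ++-assoc x p y ⟩
    x ++ p ++ y    ≡⟨ cong (x ++_) py ⟩
    x ++ y ++ p    ≡⟨ ++-assoc x y p ⟨
    (x ++ y) ++ p  ∎
    where open ≡-Reasoning

  -- x ++ y and y ++ x both commute with a long power of p, hence both are prefixes of it.
  commute-via : ∀ {p x y} → p ≢ [] → Commute p x → Commute p y → Commute x y
  commute-via {p} {x} {y} p≢[] px py =
    let _ , P≡ , _  = levi (x ++ y) P (sym (pow-commute n (commute-++ x y px py))) long
        _ , P≡′ , _ = levi (y ++ x) P (sym (pow-commute n (commute-++ y x py px)))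
                        (subst (_≤ length P) (length-++-comm x y) long)
    in proj₁ (++-injective (x ++ y) (y ++ x) (trans (sym P≡) P≡′) (length-++-comm x y))
    where
    n = length (x ++ y)
    P = pow p n
    long : n ≤ length P
    long = subst (n ≤_) (sym (length-pow p n))
      (m≤m*n n (length p) {{>-nonZero (length-positive p≢[])}})

  pow-[] : ∀ k → pow [] k ≡ []
  pow-[] zero    = refl
  pow-[] (suc k) = pow-[] k

  rotate-pow : ∀ a w k → pow (a ∷ w) k ++ a ∷ [] ≡ a ∷ pow (w ∷ʳ a) k
  rotate-pow a w zero    = refl
  rotate-pow a w (suc k) = cong (a ∷_) (begin
    (w ++ pow (a ∷ w) k) ++ a ∷ []  ≡⟨ ++-assoc w _ _ ⟩
    w ++ pow (a ∷ w) k ++ a ∷ []    ≡⟨ cong (w ++_) (rotate-pow a w k) ⟩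
    w ++ a ∷ pow (w ∷ʳ a) k         ≡⟨ ++-assoc w _ _ ⟨
    (w ∷ʳ a) ++ pow (w ∷ʳ a) k      ∎)
    where open ≡-Reasoning

  -- Each letter of `α` is moved from the front of every block to its end, so `w′` is a conjugate of
  -- `w`, and the removed letters reappear in `γ`.
  conjugate-pow : ∀ {w} k α {β} → pow w k ≡ α ++ β →
                  ∃ λ w′ → length w′ ≡ length w × ∃ λ γ → pow w′ k ≡ β ++ γ
  conjugate-pow {w} k [] {β} eq = w , refl , [] , trans eq (sym (++-identityʳ β))
  conjugate-pow zero (_ ∷ _) ()
  conjugate-pow {[]} (suc k) (_ ∷ _) eq =
    contradiction (trans (sym eq) (pow-[] k)) λ ()
  conjugate-pow {a ∷ w} (suc k) (b ∷ α) {β} eq with refl ← proj₁ (∷-injective eq) =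
    let w′ , len , γ , eq′ = conjugate-pow {w ∷ʳ a} (suc k) α {β ∷ʳ a} rotated
    in w′ , trans len (length-++-comm w (a ∷ [])) , a ∷ γ , trans eq′ (++-assoc β _ γ)
    where
    rotated : pow (w ∷ʳ a) (suc k) ≡ α ++ β ∷ʳ a
    rotated = ∷-injectiveʳ (begin
      a ∷ pow (w ∷ʳ a) (suc k)         ≡⟨ rotate-pow a w (suc k) ⟨
      pow (a ∷ w) (suc k) ++ a ∷ []    ≡⟨ cong (_∷ʳ a) eq ⟩
      a ∷ (α ++ β) ++ a ∷ []           ≡⟨ cong (a ∷_) (++-assoc α β _) ⟩
      a ∷ α ++ β ∷ʳ a                  ∎)
      where open ≡-Reasoning

  -- The exponents are chosen to give both powers the length `m * length w * length x`; as prefixes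
  -- of the same power of `w` they coincide.
  pow-prefix : ∀ {w} x k m {β} → w ≢ [] → pow w k ≡ pow x (m * length w) ++ β →
               pow x (m * length w) ≡ pow w (m * length x) × ∃ λ k′ → pow w k′ ≡ β
  pow-prefix {w} x k m {β} w≢[] eq =
    let x≡ , β≡ = ++-injective (pow x (m * length w)) (pow w j) (trans (sym eq) split) lengths
    in x≡ , k ∸ j , sym β≡
    where
    j = m * length x
    lengths : length (pow x (m * length w)) ≡ length (pow w j)
    lengths = begin
      length (pow x (m * length w))  ≡⟨ length-pow x (m * length w) ⟩
      m * length w * length x        ≡⟨ *-assoc m _ _ ⟩
      m * (length w * length x)      ≡⟨ cong (m *_) (*-comm (length w) _) ⟩
      m * (length x * length w)      ≡⟨ *-assoc m _ _ ⟨
      j * length w                   ≡⟨ length-pow w j ⟨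
      length (pow w j)               ∎
      where open ≡-Reasoning
    j≤k : j ≤ k
    j≤k = *-cancelʳ-≤ j k (length w) {{>-nonZero (length-positive w≢[])}} (begin
      j * length w                               ≡⟨ length-pow w j ⟨
      length (pow w j)                           ≡⟨ lengths ⟨
      length (pow x (m * length w))              ≤⟨ m≤m+n _ (length β) ⟩
      length (pow x (m * length w)) + length β   ≡⟨ length-++ (pow x (m * length w)) ⟨
      length (pow x (m * length w) ++ β)         ≡⟨ cong length eq ⟨
      length (pow w k)                           ≡⟨ length-pow w k ⟩
      k * length w                               ∎)
      where open ≤-Reasoning
    split : pow w k ≡ pow w j ++ pow w (k ∸ j)
    split = trans (cong (pow w) (sym (m+[n∸m]≡n j≤k))) (pow-+ w j (k ∸ j))

  -- Unless α t fits into the first block, it swallows that block, and n further copies of t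
  -- remain for the other blocks.
  one-block : ∀ ws α t {β} → t ≢ [] → StarProduct ws (α ++ pow t (suc (length ws)) ++ β) →
              ∃ λ w → w ∈ ws × ∃ λ k → ∃ λ α′ → ∃ λ β′ → pow w k ≡ α′ ++ t ++ β′
  one-block [] α t {β} t≢[] eq = contradiction
    (++-conicalˡ t [] (++-conicalˡ (t ++ []) β (++-conicalʳ α _ eq))) t≢[]
  one-block (w ∷ ws) α t {β} t≢[] (k , v , v∈ , eq)
    with ≤-total (length (α ++ t)) (length (pow w k))
  ... | inj₁ le = let e , eq′ , _ = levi (α ++ t) (pow w k) (trans regroup eq) le in
    w , here refl , k , α , e , trans eq′ (++-assoc α t e)
    where
    regroup : (α ++ t) ++ pow t (suc (length ws)) ++ β ≡ α ++ pow t (2 + length ws) ++ β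
    regroup = solve (++-monoid A)
  ... | inj₂ ge = let γ , _ , v≡ = levi (pow w k) (α ++ t) (trans (sym eq) regroup) ge
                      w , w∈ , rest = one-block ws γ t t≢[] (subst (StarProduct ws) v≡ v∈)
                  in w , there w∈ , rest
    where
    regroup : α ++ pow t (2 + length ws) ++ β ≡ (α ++ t) ++ pow t (suc (length ws)) ++ β
    regroup = solve (++-monoid A)

  -- With one more copy of `x^N y^N` than there are blocks, some copy lies inside a power of a
  -- single `w`. After conjugation it is a prefix of a power of `w′`, and both `x` and `y` turn out
  -- to commute with `w′`.
  bounded⇒commute : ∀ {ws} → All (_≢ []) ws → ∀ x y {α β} →
    (∀ m n → StarProduct ws (α ++ pow (pow x n ++ pow y n) m ++ β)) → Commute x y
  bounded⇒commute ne [] y _ = sym (++-identityʳ y)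
  bounded⇒commute ne x@(_ ∷ _) [] _ = ++-identityʳ x
  bounded⇒commute {ws} ne x@(_ ∷ _) y@(_ ∷ _) {α} all-in =
    let w , w∈ws , k , α′ , β′ , in-w = one-block ws α t t≢[] (all-in (suc (length ws)) N)
        w′ , same-length , γ , in-w′ = conjugate-pow k α′ in-w
        w′≢[] = λ w′≡[] → contradiction (cong length w′≡[])
                  (λ eq → <⇒≢ (length-positive (All.lookup ne w∈ws)) (trans (sym eq) same-length))
        -- `N` is the product of all block lengths, hence a multiple of `length w` whichever block
        -- was found.
        divides m N≡ = ∈⇒∣product (∈-map⁺ length w∈ws)
        N≡′ = trans N≡ (cong (m *_) (sym same-length))
        x≡ , k′ , rest≡ = pow-prefix x k m {pow y N ++ β′ ++ γ} w′≢[]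
          (trans in-w′ (trans regroup (cong (λ n → pow x n ++ pow y N ++ β′ ++ γ) N≡′)))
        y≡ , _ = pow-prefix y k′ m w′≢[]
          (trans rest≡ (cong (λ n → pow y n ++ β′ ++ γ) N≡′))
        -- The nonempty word `pow z N` is a power of `z` and also of `w′`, so it commutes with both.
        via = λ z z≢[] (z≡ : pow z (m * length w′) ≡ pow w′ (m * length z)) →
          commute-via (pow-nonempty {k = N} z≢[]) (pow-commute N refl)
            (subst (λ u → Commute u w′)
              (sym (trans (cong (pow z) N≡′) z≡)) (pow-commute (m * length z) refl))
    in commute-via w′≢[] (sym (via x (λ ()) x≡)) (sym (via y (λ ()) y≡))
    where
    N = product (map length ws)
    instance
      N≢0 : NonZero N
      N≢0 = product≢0 (All.map⁺ (All.map (>-nonZero ∘ length-positive) ne))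
    t = pow x N ++ pow y N
    t≢[] : t ≢ []
    t≢[] = pow-nonempty {x} {N} (λ ()) ∘ ++-conicalˡ (pow x N) _
    regroup : ∀ {β γ} → (t ++ β) ++ γ ≡ pow x N ++ pow y N ++ β ++ γ
    regroup {β} {γ} = trans (++-assoc t β γ) (++-assoc (pow x N) (pow y N) (β ++ γ))

-- Automata with commuting loops

module Automaton {m : ℕ} (D : DFA (Fin m)) where
  open DFA D

  δ* : Fin size → List (Fin m) → Fin size
  δ* = foldl step

  δ*-++ : ∀ d u v → δ* d (u ++ v) ≡ δ* (δ* d u) v
  δ*-++ = foldl-++ step

  Live : Fin size → Set
  Live d = ∃ λ v → δ* d v ∈ₛ final

  live-back : ∀ {d} u → Live (δ* d u) → Live d
  live-back {d} u (v , v∈) = u ++ v , subst (_∈ₛ final) (sym (δ*-++ d u v)) v∈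

  private
    succ : Fin size → List (Fin size)
    succ d = map (step d) (allFin m)

    path→word : ∀ {d e} → Star (Edge succ) d e → ∃ λ u → δ* d u ≡ e
    path→word ε = [] , refl
    path→word {d} (d⟶ ◅ path) with a , _ , refl ← ∈-map⁻ (step d) d⟶ =
      let u , u≡ = path→word path in a ∷ u , u≡

    word→path : ∀ d u → Star (Edge succ) d (δ* d u)
    word→path d []      = ε
    word→path d (a ∷ u) = ∈-map⁺ (step d) (∈-allFin a) ◅ word→path (step d a) u

  -- The automaton is explored without repetition, with equality as both relations: a pair found
  -- would be equal and new at once, so only the list of reachable states is left.
  live? : ∀ d → Dec (Live d)
  live? d with inj₂ (ds , sound , complete) ← Avoiding.cover-or succ _≟_ refl trans
                 (λ { refl d⟶ → _ , d⟶ , refl }) {W = ⊥} af-≡ d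
                 (λ _ _ _ same new → new (sym same))
    = map′
      (λ any → let e , e∈ , fin = find any ; u , u≡ = path→word (sound e∈) in
               u , subst (_∈ₛ final) (sym u≡) fin)
      (λ where (u , fin) → let e , e∈ , same = complete (word→path d u) in
                           lose e∈ (subst (_∈ₛ final) same fin))
      (any? (_∈ₛ? final) ds)

  δ*-pow : ∀ {d x} k → δ* d x ≡ d → δ* d (pow x k) ≡ d
  δ*-pow zero loop = refl
  δ*-pow {d} {x} (suc k) loop =
    trans (δ*-++ d x _) (trans (cong (λ e → δ* e (pow x k)) loop) (δ*-pow k loop))

  δ*-loop-++ : ∀ {d x y} → δ* d x ≡ d → δ* d y ≡ d → δ* d (x ++ y) ≡ d
  δ*-loop-++ {d} {x} {y} loop-x loop-y =
    trans (δ*-++ d x y) (trans (cong (λ e → δ* e y) loop-x) loop-y)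

  LoopsCommute : Set
  LoopsCommute = ∀ α x y → Live (δ* start α) → δ* (δ* start α) x ≡ δ* start α →
                 δ* (δ* start α) y ≡ δ* start α → Commute x y

  -- Iterating the two loops between `α` and an accepted continuation `β` stays within the language,
  -- which is the premise of `bounded⇒commute`.
  loops-commute : ∀ {L} → L ≐ Accepts → Bounded L → LoopsCommute
  loops-commute (_ , accepts⊆L) (ws , nonempty , L⊆) α x y (β , fin) loop-x loop-y =
    bounded⇒commute nonempty x y {α} {β} λ m n → L⊆ (accepts⊆L (subst (_∈ₛ final)
      (sym (begin
        δ* start (α ++ pow (pow x n ++ pow y n) m ++ β)
          ≡⟨ δ*-++ start α _ ⟩
        δ* (δ* start α) (pow (pow x n ++ pow y n) m ++ β)
          ≡⟨ δ*-++ _ (pow (pow x n ++ pow y n) m) β ⟩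
        δ* (δ* (δ* start α) (pow (pow x n ++ pow y n) m)) β
          ≡⟨ cong (λ d → δ* d β) (δ*-pow m (δ*-loop-++ {x = pow x n} (δ*-pow n loop-x) (δ*-pow n loop-y))) ⟩
        δ* (δ* start α) β
          ∎))
      fin))
    where open ≡-Reasoning

  Channel : Set
  Channel = List (Fin m) × List (Fin m)

  -- In a snapshot (r , u) of a channel, r is the word received so far and u the contents.
  -- If x is sent and y received between two snapshots, then u′ = u z with z x = x z says that
  -- the same actions can be repeated for ever, adding z to the contents each time.
  Pumps : Rel Channel 0ℓ
  Pumps (r , u) (r′ , u′) = Live (δ* start r′) → ∀ {x y} → r′ ≡ r ++ y → u ++ x ≡ y ++ u′ →
                            ∃ λ z → u′ ≡ u ++ z × Commute z x

  private
    -- `r ++ u` is everything sent so far, so `state-sent` is where the receiver will be after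
    -- consuming the present contents.
    state-received state-sent : Channel → Fin size
    state-received (r , u) = δ* start r
    state-sent (r , u) = δ* start (r ++ u)

    Similar : Rel Channel 0ℓ
    Similar p q = state-received p ≡ state-received q × state-sent p ≡ state-sent q
                × length (proj₂ p) ≤ length (proj₂ q)

    af-similar : AlmostFull Similar
    af-similar = af-∩ (af-on state-received af-≡)
      (af-∩ (af-on state-sent af-≡) (af-on (length ∘ proj₂) af-≤))

  -- The receiver completes the loop u₂ v from the common state d, as it does for u₁ v; the
  -- two loops commute, whence u₁ is a prefix of u₂.
  similar⇒pumps : LoopsCommute → ∀ {r₁ u₁ r₂ u₂} → Similar (r₁ , u₁) (r₂ , u₂) → ∀ v →
                  δ* start ((r₂ ++ u₂) ++ v) ≡ δ* start r₁ → Pumps (r₁ , u₁) (r₂ , u₂)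
  similar⇒pumps commute {r₁} {u₁} {r₂} {u₂} (same-r , same-s , shorter) v back live {x} {y} r₂≡ u₁x≡ =
    let z , u₂≡ , _ = levi u₁ u₂ swap-loops shorter
    -- Both `z` and `x` are loops at `e`, which is live because `v` leads from it to the live state
    -- `d`.
    in z , u₂≡ , commute (r₁ ++ u₁) z x (live-back v (subst Live (sym loop₁) live-d)) (loop-z z u₂≡) loop-x
    where
    open ≡-Reasoning
    d = δ* start r₁
    e = δ* start (r₁ ++ u₁)
    live-d : Live d
    live-d = subst Live (sym same-r) live
    loop₁ : δ* e v ≡ d
    loop₁ = begin
      δ* e v                          ≡⟨ cong (λ s → δ* s v) same-s ⟩
      δ* (δ* start (r₂ ++ u₂)) v      ≡⟨ δ*-++ start (r₂ ++ u₂) v ⟨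
      δ* start ((r₂ ++ u₂) ++ v)      ≡⟨ back ⟩
      d                               ∎
    from-d : ∀ r u → δ* start r ≡ d → δ* start (r ++ u) ≡ e → δ* d (u ++ v) ≡ d
    from-d r u r≡ s≡ = begin
      δ* d (u ++ v)                ≡⟨ δ*-++ d u v ⟩
      δ* (δ* d u) v                ≡⟨ cong (λ s → δ* (δ* s u) v) r≡ ⟨
      δ* (δ* (δ* start r) u) v     ≡⟨ cong (λ s → δ* s v) (δ*-++ start r u) ⟨
      δ* (δ* start (r ++ u)) v     ≡⟨ cong (λ s → δ* s v) s≡ ⟩
      δ* e v                       ≡⟨ loop₁ ⟩
      d                            ∎
    swap-loops : u₁ ++ v ++ u₂ ++ v ≡ u₂ ++ v ++ u₁ ++ v
    swap-loops = begin
      u₁ ++ v ++ u₂ ++ v      ≡⟨ ++-assoc u₁ v _ ⟨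
      (u₁ ++ v) ++ u₂ ++ v    ≡⟨ commute r₁ (u₁ ++ v) (u₂ ++ v) live-d
                                   (from-d r₁ u₁ refl refl) (from-d r₂ u₂ (sym same-r) (sym same-s)) ⟩
      (u₂ ++ v) ++ u₁ ++ v    ≡⟨ ++-assoc u₂ v _ ⟩
      u₂ ++ v ++ u₁ ++ v      ∎
    loop-z : ∀ z → u₂ ≡ u₁ ++ z → δ* e z ≡ e
    loop-z z u₂≡ = begin
      δ* e z                          ≡⟨ cong (λ s → δ* s z) (δ*-++ start r₁ u₁) ⟩
      δ* (δ* d u₁) z                  ≡⟨ δ*-++ d u₁ z ⟨
      δ* d (u₁ ++ z)                  ≡⟨ cong₂ δ* same-r (sym u₂≡) ⟩
      δ* (δ* start r₂) u₂             ≡⟨ δ*-++ start r₂ u₂ ⟨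
      δ* start (r₂ ++ u₂)             ≡⟨ same-s ⟨
      e                               ∎
    loop-x : δ* e x ≡ e
    loop-x = begin
      δ* e x                          ≡⟨ δ*-++ start (r₁ ++ u₁) x ⟨
      δ* start ((r₁ ++ u₁) ++ x)      ≡⟨ cong (δ* start) (++-assoc r₁ u₁ x) ⟩
      δ* start (r₁ ++ u₁ ++ x)        ≡⟨ cong (λ w → δ* start (r₁ ++ w)) u₁x≡ ⟩
      δ* start (r₁ ++ y ++ u₂)        ≡⟨ cong (δ* start) (++-assoc r₁ y u₂) ⟨
      δ* start ((r₁ ++ y) ++ u₂)      ≡⟨ cong (λ r → δ* start (r ++ u₂)) r₂≡ ⟨
      δ* start (r₂ ++ u₂)             ≡⟨ same-s ⟨
      e                               ∎

  -- Nothing is received in between, so `z` is the sent word `x` itself and commutes with it.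
  stalled⇒pumps : ∀ {r u r′ u′} → length r′ ≤ length r → Pumps (r , u) (r′ , u′)
  stalled⇒pumps {r} {u} {r′} {u′} shorter _ {x} {y} r′≡ ux≡ with y
  ... | []    = x , sym ux≡ , refl
  ... | _ ∷ _ = contradiction shorter (<⇒≱ (subst (length r <_)
                  (sym (trans (cong length r′≡) (length-++ r))) (m<m+n (length r) (s≤s z≤n))))

  prefix? : ∀ (u w : List (Fin m)) → Dec (∃ λ v → w ≡ u ++ v)
  prefix? u w = map′ (drop (length u) w ,_) (λ where (v , refl) → cong (u ++_) (sym (drop-++ u v)))
    (≡-dec _≟_ w (u ++ drop (length u) w))

  -- Fix the receiver's state d. After a similar pair p, q in state d, the receiver can return
  -- to d only before consuming everything sent by the time of q, hence must stall, or
  -- afterwards, which makes (p , q) pump.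
  af-pumps-at : LoopsCommute → ∀ d → AlmostFull (λ p q → Pumps p q ⊎ state-received p ≢ d)
  af-pumps-at commute d = af-bind af-similar once
    where
    C : Rel Channel 0ℓ
    C p q = Pumps p q ⊎ state-received p ≢ d

    once : ∀ p q → Similar p q → AlmostFull ((C after p) after q)
    once p@(r₁ , u₁) q@(r₂ , u₂) similar with state-received p ≟ d
    ... | no  ≢d   = now λ _ _ → inj₂ (inj₂ (inj₂ ≢d))
    ... | yes refl = af-mono (λ {x} {y} → repeated x y)
      -- Below `N` received letters, a pair of this relation has received nothing new and is
      -- stalled; from `N` on, the subtraction is constantly zero and `r` is compared with
      -- `r₂ ++ u₂` instead.
      (af-on (λ x → N ∸ length (proj₁ x)) af-≤)
      where
      N = length (r₂ ++ u₂)
      ∸-reflects-≤ : ∀ {k l} → k < N → N ∸ k ≤ N ∸ l → l ≤ k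
      ∸-reflects-≤ {k} {l} k<N N∸k≤ with ≤-total l N
      ... | inj₁ l≤N = ≮⇒≥ λ k<l → <⇒≱ (∸-monoʳ-< k<l l≤N) N∸k≤
      ... | inj₂ N≤l = contradiction (subst (N ∸ k ≤_) (m≤n⇒m∸n≡0 N≤l) N∸k≤) (<⇒≱ (m<n⇒0<n∸m k<N))
      repeated : ∀ x y → N ∸ length (proj₁ x) ≤ N ∸ length (proj₁ y) →
                 ((C after p) after q) x y
      repeated x@(r , u) y@(r′ , u′) N∸≤ with state-received x ≟ d
      ... | no ≢d = inj₁ (inj₁ (inj₂ ≢d))
      ... | yes at-d with <-≤-connex (length r) N | prefix? (r₂ ++ u₂) r
      ...   | inj₁ r<N | _ = inj₁ (inj₁ (inj₁ (stalled⇒pumps (∸-reflects-≤ r<N N∸≤))))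
      ...   | inj₂ N≤r | yes (v , refl) = inj₂ (inj₂ (inj₁ (similar⇒pumps commute similar v at-d)))
      -- A receiver that got this far after `q` would have consumed `r₂ ++ u₂` first. So `x` cannot
      -- follow `q`, and `Pumps q x` holds vacuously.
      ...   | inj₂ N≤r | no not-prefix = inj₂ (inj₁ (inj₁ λ _ {x′} {y′} r≡ u₂x′≡ →
                let v , r≡′ , _ = levi (r₂ ++ u₂) r (begin
                      (r₂ ++ u₂) ++ x′  ≡⟨ ++-assoc r₂ u₂ x′ ⟩
                      r₂ ++ u₂ ++ x′    ≡⟨ cong (r₂ ++_) u₂x′≡ ⟩
                      r₂ ++ y′ ++ u     ≡⟨ ++-assoc r₂ y′ u ⟨
                      (r₂ ++ y′) ++ u   ≡⟨ cong (_++ u) r≡ ⟨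
                      r ++ u            ∎) N≤r
                in contradiction (v , r≡′) not-prefix))
        where open ≡-Reasoning

  -- There are finitely many states `d`, so the relations for all of them are intersected; the
  -- instance at the state of `p` itself leaves only `Pumps`.
  af-pumps : LoopsCommute → AlmostFull Pumps
  af-pumps commute = af-mono (λ {p} at → resolve (at (state-received p)))
    (af-∀ (af-pumps-at commute))
    where
    resolve : ∀ {p q} → Pumps p q ⊎ state-received p ≢ state-received p → Pumps p q
    resolve (inj₁ pumps) = pumps
    resolve (inj₂ ≢)     = contradiction refl ≢

-- FIFO machines

module Machine (M : FIFOMachine) where
  open FIFOMachine M

  Contents : Set
  Contents = ∀ c → List (Letter c)

  sent : (c : Channel) → Act → Maybe (Letter c)
  sent c (d ⁇ a) = nothing
  sent c (d ! a) with d ≟ c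
  ... | yes refl = just a
  ... | no  _    = nothing

  proj! : (c : Channel) → List Act → List (Letter c)
  proj! c = mapMaybe (sent c)

  proj : (c : Channel) → List Act → List (Letter c)
  proj = proj⁇ M

  proj-++ : ∀ c σ τ → proj c (σ ++ τ) ≡ proj c σ ++ proj c τ
  proj-++ c = mapMaybe-++ (received M c)

  received-same : ∀ c a → received M c (c ⁇ a) ≡ just a
  received-same c a with c ≟ c
  ... | yes refl = refl
  ... | no  c≢c  = contradiction refl c≢c

  received-other : ∀ {c d} a → d ≢ c → received M d (c ⁇ a) ≡ nothing
  received-other {c} {d} a d≢c with c ≟ d
  ... | yes refl = contradiction refl d≢c
  ... | no  _    = refl

  -- Both kinds of action satisfy (received) w′ = w (sent) on every channel.
  Balanced : Act → Rel Contents 0ℓ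
  Balanced β w w′ = ∀ c → proj c (β ∷ []) ++ w′ c ≡ w c ++ proj! c (β ∷ [])

  step⇒balanced : ∀ {q w β q′ w′} → Step M (q , w) β (q′ , w′) → Balanced β w w′
  step⇒balanced (send {c = c} _ w′c w′d) d with c ≟ d
  ... | yes refl = w′c
  ... | no  c≢d  = trans (w′d d (c≢d ∘ sym)) (sym (++-identityʳ _))
  step⇒balanced (recv {c = c} _ wc w′d) d with c ≟ d
  ... | yes refl = trans (sym wc) (sym (++-identityʳ _))
  ... | no  c≢d  = trans (w′d d (c≢d ∘ sym)) (sym (++-identityʳ _))

  step⇒transition : ∀ {q w β q′ w′} → Step M (q , w) β (q′ , w′) → (q , β , q′) ∈ Δ
  step⇒transition (send t _ _) = t
  step⇒transition (recv t _ _) = t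

  balanced⇒step : ∀ {q w β q′ w′} → (q , β , q′) ∈ Δ → Balanced β w w′ →
                  Step M (q , w) β (q′ , w′)
  balanced⇒step {w = w} {c ! a} {w′ = w′} t bal = send t same other
    where
    same : w′ c ≡ w c ∷ʳ a
    same with c ≟ c | bal c
    ... | yes refl | eq = eq
    ... | no  c≢c  | _  = contradiction refl c≢c
    other : ∀ d → d ≢ c → w′ d ≡ w d
    other d d≢c with c ≟ d | bal d
    ... | yes refl | _  = contradiction refl d≢c
    ... | no  _    | eq = trans eq (++-identityʳ _)
  balanced⇒step {w = w} {c ⁇ a} {w′ = w′} t bal = recv t same other
    where
    same : w c ≡ a ∷ w′ c
    same with c ≟ c | bal c
    ... | yes refl | eq = sym (trans eq (++-identityʳ _))
    ... | no  c≢c  | _  = contradiction refl c≢c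
    other : ∀ d → d ≢ c → w′ d ≡ w d
    other d d≢c with c ≟ d | bal d
    ... | yes refl | _  = contradiction refl d≢c
    ... | no  _    | eq = trans eq (++-identityʳ _)

  _▹▹_ : ∀ {s t u σ τ} → Run M s σ t → Run M t τ u → Run M s (σ ++ τ) u
  []         ▹▹ run′ = run′
  (st ∷ run) ▹▹ run′ = st ∷ (run ▹▹ run′)

  run-balanced : ∀ {q w σ q′ w′} → Run M (q , w) σ (q′ , w′) →
                 ∀ c → w c ++ proj! c σ ≡ proj c σ ++ w′ c
  run-balanced [] c = ++-identityʳ _
  run-balanced {w = w} {β ∷ σ} {w′ = w′} (_∷_ {t = _ , w₁} st run) c = begin
    w c ++ proj! c (β ∷ σ)                     ≡⟨ cong (w c ++_) (mapMaybe-++ (sent c) (β ∷ []) σ) ⟩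
    w c ++ proj! c (β ∷ []) ++ proj! c σ       ≡⟨ ++-assoc (w c) _ _ ⟨
    (w c ++ proj! c (β ∷ [])) ++ proj! c σ     ≡⟨ cong (_++ proj! c σ) (step⇒balanced st c) ⟨
    (proj c (β ∷ []) ++ w₁ c) ++ proj! c σ     ≡⟨ ++-assoc (proj c (β ∷ [])) _ _ ⟩
    proj c (β ∷ []) ++ w₁ c ++ proj! c σ       ≡⟨ cong (proj c (β ∷ []) ++_) (run-balanced run c) ⟩
    proj c (β ∷ []) ++ proj c σ ++ w′ c        ≡⟨ ++-assoc (proj c (β ∷ [])) _ _ ⟨
    (proj c (β ∷ []) ++ proj c σ) ++ w′ c      ≡⟨ cong (_++ w′ c) (proj-++ c (β ∷ []) σ) ⟨
    proj c (β ∷ σ) ++ w′ c                     ∎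
    where open ≡-Reasoning

  -- The hypothesis on `v` is an invariant, with `σ` the actions still to come. It makes `v` at
  -- least as long as `w`, so every reception finds its letter, and at the end of the run it becomes
  -- the claim on `v′`.
  pump-run : ∀ {q w σ q′ w′} → Run M (q , w) σ (q′ , w′) → ∀ {v} (t : Contents) →
             (∀ c → v c ++ proj! c σ ≡ w c ++ proj! c σ ++ t c) →
             ∃ λ v′ → Run M (q , v) σ (q′ , v′) × (∀ c → v′ c ≡ w′ c ++ t c)
  pump-run [] t v≡ = _ , [] , λ c → trans (sym (++-identityʳ _)) (v≡ c)
  pump-run {w = w} {β ∷ σ} (_∷_ {t = _ , w₁} st run) {v} t v≡ =
    let v′ , run′ , v′≡ = pump-run run t (λ c → sym (proj₂ (proj₂ (split c))))
    in v′ , balanced⇒step (step⇒transition st) (λ c → sym (proj₁ (proj₂ (split c)))) ∷ run′ , v′≡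
    where
    module _ (c : Channel) where
      r = proj c (β ∷ [])
      s = proj! c (β ∷ [])
      x = proj! c σ

      total : v c ++ s ++ x ≡ w c ++ (s ++ x) ++ t c
      total = subst (λ y → v c ++ y ≡ w c ++ y ++ t c) (mapMaybe-++ (sent c) (β ∷ []) σ) (v≡ c)

      longer : length (w c) ≤ length (v c)
      longer = +-cancelʳ-≤ (length (s ++ x)) (length (w c)) (length (v c)) (begin
        length (w c) + length (s ++ x)          ≡⟨ length-++ (w c) ⟨
        length (w c ++ s ++ x)                  ≤⟨ length-++-≤ˡ (w c ++ s ++ x) ⟩
        length ((w c ++ s ++ x) ++ t c)         ≡⟨ cong length (++-assoc (w c) (s ++ x) (t c)) ⟩
        length (w c ++ (s ++ x) ++ t c)         ≡⟨ cong length total ⟨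
        length (v c ++ s ++ x)                  ≡⟨ length-++ (v c) ⟩
        length (v c) + length (s ++ x)          ∎)
        where open ≤-Reasoning

      enough : length r ≤ length (v c ++ s)
      enough = begin
        length r                     ≤⟨ length-++-≤ˡ r ⟩
        length (r ++ w₁ c)           ≡⟨ cong length (step⇒balanced st c) ⟩
        length (w c ++ s)            ≡⟨ length-++ (w c) ⟩
        length (w c) + length s      ≤⟨ +-monoˡ-≤ (length s) longer ⟩
        length (v c) + length s      ≡⟨ length-++ (v c) ⟨
        length (v c ++ s)            ∎
        where open ≤-Reasoning

      split : ∃ λ e → v c ++ s ≡ r ++ e × w₁ c ++ x ++ t c ≡ e ++ x
      split = levi r (v c ++ s) (begin
        r ++ w₁ c ++ x ++ t c        ≡⟨ ++-assoc r (w₁ c) _ ⟨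
        (r ++ w₁ c) ++ x ++ t c      ≡⟨ cong (_++ x ++ t c) (step⇒balanced st c) ⟩
        (w c ++ s) ++ x ++ t c       ≡⟨ ++-assoc (w c) s _ ⟩
        w c ++ s ++ x ++ t c         ≡⟨ cong (w c ++_) (++-assoc s x (t c)) ⟨
        w c ++ (s ++ x) ++ t c       ≡⟨ total ⟨
        v c ++ s ++ x                ≡⟨ ++-assoc (v c) s x ⟨
        (v c ++ s) ++ x              ∎) enough
        where open ≡-Reasoning

  -- Joins completions chosen separately for each channel into one label word. `Pref` asks only for
  -- a word, not for one that the machine can perform.
  receptions : (v : Contents) → ∃ λ σ → ∀ c → proj c σ ≡ v c
  receptions v = let σ , on , off = build (allFin #channels) in σ , λ c → on c (∈-allFin c)
    where
    proj-same : ∀ c u → proj c (map (c ⁇_) u) ≡ u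
    proj-same c = mapMaybe-map-retract (received-same c)
    proj-other : ∀ {c d} → d ≢ c → ∀ u → proj d (map (c ⁇_) u) ≡ []
    proj-other d≢c = mapMaybe-map-none (λ a → received-other a d≢c)
    build : ∀ cs → ∃ λ σ → (∀ c → c ∈ cs → proj c σ ≡ v c) × (∀ c → ¬ c ∈ cs → proj c σ ≡ [])
    build [] = [] , (λ _ ()) , λ _ _ → refl
    build (d ∷ cs) with build cs | any? (d ≟_) cs
    ... | σ , on , off | yes d∈ = σ , (λ { c (here refl) → on c d∈ ; c (there c∈) → on c c∈ })
                                    , λ c c∉ → off c (c∉ ∘ there)
    ... | σ , on , off | no d∉ = σ′ , on′ , λ c c∉ → trans (other (c∉ ∘ here)) (off c (c∉ ∘ there))
      where
      σ′ = map (d ⁇_) (v d) ++ σ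
      other : ∀ {c} → c ≢ d → proj c σ′ ≡ proj c σ
      other {c} c≢d = trans (proj-++ c (map (d ⁇_) (v d)) σ) (cong (_++ proj c σ) (proj-other c≢d (v d)))
      on′ : ∀ c → c ∈ d ∷ cs → proj c σ′ ≡ v c
      on′ c c∈ with c ≟ d | c∈
      ... | yes refl | _ = trans (proj-++ c (map (c ⁇_) (v c)) σ)
        (trans (cong₂ _++_ (proj-same c (v c)) (off c d∉)) (++-identityʳ _))
      ... | no  c≢d  | here c≡d = contradiction c≡d c≢d
      ... | no  c≢d  | there c∈cs = trans (other c≢d) (on c c∈cs)

-- Lassos and the executions they generate

module Decision (M : FIFOMachine)
  (L : (c : FIFOMachine.Channel M) → Language (FIFOMachine.Letter M c))
  (regular : ∀ c → Regular (L c)) (bounded : ∀ c → Bounded (L c)) where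

  open FIFOMachine M
  open Machine M
  private module A (c : Channel) = Automaton (proj₁ (regular c))

  Control : Channel → Set
  Control c = Fin (DFA.size (proj₁ (regular c)))

  state : ∀ c → List (Letter c) → Control c
  state c = A.δ* c (DFA.start (proj₁ (regular c)))

  state-++ : ∀ c u v → state c (u ++ v) ≡ A.δ* c (state c u) v
  state-++ c = A.δ*-++ c _

  Allowed : Language Act
  Allowed = Pref (OutputLanguage M L)

  live⇒allowed : ∀ σ → (∀ c → A.Live c (state c (proj c σ))) → Allowed σ
  live⇒allowed σ live =
    let τ , τ≡ = receptions (λ c → proj₁ (live c)) in
    τ , λ c → proj₂ (proj₂ (regular c)) (subst (DFA.Accepts (proj₁ (regular c)))
      (trans (cong (proj c σ ++_) (sym (τ≡ c))) (sym (proj-++ c σ τ)))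
      (subst (_∈ₛ _) (sym (state-++ c (proj c σ) _)) (proj₂ (live c))))

  allowed⇒live : ∀ σ → Allowed σ → ∀ c → A.Live c (state c (proj c σ))
  allowed⇒live σ (τ , στ∈L) c = proj c τ ,
    subst (_∈ₛ _) (trans (cong (state c) (proj-++ c σ τ)) (state-++ c (proj c σ) _))
      (proj₁ (proj₂ (regular c)) (στ∈L c))

  -- A finite certificate of an infinite execution: `phase` lets the cycle run again from the longer
  -- contents, while `live` and `loop` keep every repetition allowed. The form `β ∷ τ` makes the
  -- cycle nonempty.
  record Lasso : Set where
    field
      {σ τ}  : List Act
      {β}    : Act
      {q}    : State
      {w w′} : Contents
      stem   : Run M (initial M) σ (q , w)
      cycle  : Run M (q , w) (β ∷ τ) (q , w′)
      z      : Contents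
      grows  : ∀ c → w′ c ≡ w c ++ z c
      phase  : ∀ c → Commute (z c) (proj! c (β ∷ τ))
      live   : ∀ c → A.Live c (state c (proj c σ))
      loop   : ∀ c → A.δ* c (state c (proj c σ)) (proj c (β ∷ τ)) ≡ state c (proj c σ)

    Repeatable : Contents → Set
    Repeatable v = ∃ λ v′ → Run M (q , v) (β ∷ τ) (q , v′) × (∀ c → v′ c ≡ v c ++ z c)

    -- By `phase` the added `z c` may be moved behind the word sent in the cycle, as `pump-run`
    -- requires.
    repeat-again : ∀ {v} ((v′ , _) : Repeatable v) → Repeatable v′
    repeat-again {v} (v′ , run , v′≡) = pump-run run z λ c → begin
      v′ c ++ proj! c (β ∷ τ)           ≡⟨ cong (_++ proj! c (β ∷ τ)) (v′≡ c) ⟩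
      (v c ++ z c) ++ proj! c (β ∷ τ)   ≡⟨ ++-assoc (v c) (z c) _ ⟩
      v c ++ z c ++ proj! c (β ∷ τ)     ≡⟨ cong (v c ++_) (phase c) ⟩
      v c ++ proj! c (β ∷ τ) ++ z c     ∎
      where open ≡-Reasoning

    Returns : List Act → Set
    Returns ρ = ∀ c → state c (proj c ρ) ≡ state c (proj c σ)

    returns-cycle : ∀ {ρ} → Returns ρ → Returns (ρ ++ β ∷ τ)
    returns-cycle {ρ} ret c = begin
      state c (proj c (ρ ++ β ∷ τ))                    ≡⟨ cong (state c) (proj-++ c ρ (β ∷ τ)) ⟩
      state c (proj c ρ ++ proj c (β ∷ τ))             ≡⟨ state-++ c (proj c ρ) _ ⟩
      A.δ* c (state c (proj c ρ)) (proj c (β ∷ τ))     ≡⟨ cong (λ d → A.δ* c d (proj c (β ∷ τ))) (ret c) ⟩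
      A.δ* c (state c (proj c σ)) (proj c (β ∷ τ))     ≡⟨ loop c ⟩
      state c (proj c σ)                               ∎
      where open ≡-Reasoning

  module _ (lasso : Lasso) where
    open Lasso lasso

    private
      -- After the actions ρ, it remains to perform π to complete the current cycle.
      record Progress (ρ : List Act) : Set where
        field
          {π}        : List Act
          current    : Config M
          {v}        : Contents
          rest       : Run M current π (q , v)
          repeatable : Repeatable v
          returns    : Returns (ρ ++ π)

      open Progress

      emit : ∀ {ρ s α t π v} → Step M s α t → Run M t π (q , v) → Repeatable v →
             Returns (ρ ++ α ∷ π) → ∃ λ α → ∃ λ (p : Progress (ρ ∷ʳ α)) → Step M s α (current p)
      emit {ρ} {α = α} {π = π} st run rep ret = α , record
        { rest = run ; repeatable = rep ; returns = subst Returns (sym (++-assoc ρ (α ∷ []) π)) ret }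
        , st

      advance : ∀ {ρ} (p : Progress ρ) →
                ∃ λ α → ∃ λ (p′ : Progress (ρ ∷ʳ α)) → Step M (current p) α (current p′)
      advance record { rest = st ∷ run ; repeatable = rep ; returns = ret } = emit st run rep ret
      -- The current round is complete, and the next one has a first step because the cycle is
      -- nonempty.
      advance {ρ} record { rest = [] ; repeatable = rep@(_ , st ∷ run , _) ; returns = ret } =
        emit st run (repeat-again rep)
          (returns-cycle {ρ} (subst Returns (++-identityʳ ρ) ret))

      history : ℕ → ∃ Progress
      history zero    = [] , record
        { rest = stem ; repeatable = _ , cycle , grows ; returns = λ _ → refl }
      history (suc i) = let α , p , _ = advance (proj₂ (history i)) in _ , p

      label : ℕ → Act
      label i = proj₁ (advance (proj₂ (history i)))

      emitted : ∀ i → proj₁ (history i) ≡ applyUpTo label i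
      emitted zero    = refl
      emitted (suc i) = trans (cong (_∷ʳ label i) (emitted i)) (applyUpTo-∷ʳ label i)

      progress-live : ∀ {ρ} → Progress ρ → ∀ c → A.Live c (state c (proj c ρ))
      progress-live {ρ} p c = A.live-back c (proj c (π p)) (subst (A.Live c)
        (trans (sym (returns p c)) (trans (cong (state c) (proj-++ c ρ (π p))) (state-++ c (proj c ρ) _)))
        (live c))

    lasso⇒execution : InfiniteExecution M Allowed
    lasso⇒execution = record
      { config  = λ i → current (proj₂ (history i))
      ; label   = label
      ; starts  = refl
      ; steps   = λ i → proj₂ (proj₂ (advance (proj₂ (history i))))
      ; allowed = λ i → subst Allowed (emitted i) (live⇒allowed (proj₁ (history i)) (progress-live (proj₂ (history i))))
      }

    private
      iterated : ∀ c → z c ≢ [] → ∀ k → ∃ λ ρ → ∃ λ v →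
                 Run M (initial M) ρ (q , v) × Returns ρ × Repeatable v × k ≤ length (v c)
      iterated c z≢[] zero = _ , _ , stem , (λ _ → refl) , (_ , cycle , grows) , z≤n
      iterated c z≢[] (suc k) =
        let ρ , v , run , ret , rep@(v′ , again , v′≡) , k≤ = iterated c z≢[] k in
        ρ ++ β ∷ τ , v′ , run ▹▹ again , returns-cycle {ρ} ret , repeat-again rep , (begin
          suc k                            ≡⟨ +-comm 1 k ⟩
          k + 1                            ≤⟨ +-mono-≤ k≤ (length-positive z≢[]) ⟩
          length (v c) + length (z c)      ≡⟨ length-++ (v c) ⟨
          length (v c ++ z c)              ≡⟨ cong length (v′≡ c) ⟨
          length (v′ c)                    ∎)
        where open ≤-Reasoning

      longest : ∀ c (ss : List (Config M)) →
                ∃ λ N → ∀ {s} → Any (_≈_ M s) ss → length (proj₂ s c) ≤ N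
      longest c [] = 0 , λ ()
      longest c ((_ , w) ∷ ss) = let N , bound = longest c ss in length (w c) + N , λ where
        (here (_ , w≡)) → ≤-trans (≤-reflexive (cong length (w≡ c))) (m≤m+n _ N)
        (there s∈)      → ≤-trans (bound s∈) (m≤n+m N _)

    -- After `k` rounds channel `c` holds at least `k` letters, whereas a finite list of
    -- configurations bounds its length.
    growing-lasso⇒unbounded : ∀ c → z c ≢ [] → OBUnbounded M L
    growing-lasso⇒unbounded c z≢[] (ss , all-in) =
      let N , bound = longest c ss
          ρ , v , run , ret , _ , long = iterated c z≢[] (suc N)
          reach = ρ , live⇒allowed ρ (λ d → subst (A.Live d) (sym (ret d)) (live d)) , run
      in <⇒≱ long (bound (all-in (q , v) reach))

  -- The transition system of allowed runs

  record Node : Set where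
    constructor node
    field
      ctl     : State
      rcv buf : Contents

    config : Config M
    config = ctl , buf

    states : ∀ c → Control c
    states c = state c (rcv c)
  open Node

  root : Node
  root = node q₀ (λ _ → []) (λ _ → [])

  Transition : Set
  Transition = State × Act × State

  -- `drop` gives a result even if the channel is empty or has another letter at its head; the
  -- balance equation in `Enabled` rejects these cases.
  fire : Node → Transition → Node
  fire x (_ , β , q) = node q
    (λ c → rcv x c ++ proj c (β ∷ []))
    (λ c → drop (length (proj c (β ∷ []))) (buf x c ++ proj! c (β ∷ [])))

  Enabled : Node → Transition → Set
  Enabled x t@(q , β , _) = q ≡ ctl x × Balanced β (buf x) (buf (fire x t))
                          × (∀ c → A.Live c (states (fire x t) c))

  enabled? : ∀ x t → Dec (Enabled x t)
  enabled? x t@(q , β , _) = (q ≟ ctl x)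
    ×-dec allFin? (λ c → ≡-dec _≟_ _ _)
    ×-dec allFin? (λ c → A.live? c _)

  succ : Node → List Node
  succ x = map (fire x) (filter (enabled? x) Δ)

  _⟶_ : Rel Node 0ℓ
  _⟶_ = Edge succ

  edge⇒step : ∀ {x y} → x ⟶ y → ∃ λ β → Step M (config x) β (config y)
              × (∀ c → rcv y c ≡ rcv x c ++ proj c (β ∷ [])) × (∀ c → A.Live c (states y c))
  edge⇒step {x} x⟶y
    with (q , β , q′) , t∈ , refl ← ∈-map⁻ (fire x) x⟶y
    with t∈Δ , refl , bal , live ← ∈-filter⁻ (enabled? x) t∈
    = β , balanced⇒step t∈Δ bal , (λ _ → refl) , live

  step⇒edge : ∀ x {w β q′ w′} → (∀ c → w c ≡ buf x c) → Step M (ctl x , w) β (q′ , w′) →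
              (∀ c → A.Live c (state c (rcv x c ++ proj c (β ∷ [])))) →
              ∃ λ y → x ⟶ y × ctl y ≡ q′ × (∀ c → w′ c ≡ buf y c)
                × (∀ c → rcv y c ≡ rcv x c ++ proj c (β ∷ []))
  step⇒edge x {w} {β} {q′} {w′} w≡ st live = fire x t ,
    ∈-map⁺ (fire x) (∈-filter⁺ (enabled? x) (step⇒transition st) (refl , bal , live)) ,
    refl , w′≡ , λ _ → refl
    where
    t : Transition
    t = ctl x , β , q′
    bal₀ : ∀ c → proj c (β ∷ []) ++ w′ c ≡ buf x c ++ proj! c (β ∷ [])
    bal₀ c = trans (step⇒balanced st c) (cong (_++ proj! c (β ∷ [])) (w≡ c))
    w′≡ : ∀ c → w′ c ≡ buf (fire x t) c
    w′≡ c = trans (sym (drop-++ (proj c (β ∷ [])) (w′ c)))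
                  (cong (drop (length (proj c (β ∷ [])))) (bal₀ c))
    bal : Balanced β (buf x) (buf (fire x t))
    bal c = trans (cong (proj c (β ∷ []) ++_) (sym (w′≡ c))) (bal₀ c)

  path⇒run : ∀ {x y} → Star _⟶_ x y → ∃ λ σ → Run M (config x) σ (config y)
             × (∀ c → rcv y c ≡ rcv x c ++ proj c σ)
  path⇒run ε = [] , [] , λ _ → sym (++-identityʳ _)
  path⇒run {x} (x⟶x′ ◅ path) =
    let β , st , r≡ , _  = edge⇒step x⟶x′
        σ , run , r≡′    = path⇒run path
    in β ∷ σ , st ∷ run , λ c → trans (r≡′ c) (trans (cong (_++ proj c σ) (r≡ c))
         (trans (++-assoc (rcv x c) _ _) (cong (rcv x c ++_) (sym (proj-++ c (β ∷ []) σ)))))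

  target-live : ∀ {x y z} → x ⟶ y → Star _⟶_ y z → ∀ c → A.Live c (states z c)
  target-live x⟶y ε             = proj₂ (proj₂ (proj₂ (edge⇒step x⟶y)))
  target-live x⟶y (y⟶y′ ◅ path) = target-live y⟶y′ path

  -- Liveness at the end of the run passes back to every earlier point, so each step on the way is
  -- an enabled edge.
  run⇒path : ∀ x {s σ s′} → _≈_ M s (config x) → Run M s σ s′ →
             (∀ c → A.Live c (state c (rcv x c ++ proj c σ))) →
             ∃ λ y → Star _⟶_ x y × _≈_ M s′ (config y)
  run⇒path x s≈ [] live = x , ε , s≈
  run⇒path x {σ = β ∷ σ} (refl , w≡) (st ∷ run) live =
    let split = λ c → trans (cong (rcv x c ++_) (proj-++ c (β ∷ []) σ)) (sym (++-assoc (rcv x c) _ _))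
        live₁ = λ c → A.live-back c (proj c σ) (subst (A.Live c)
                  (trans (cong (state c) (split c)) (state-++ c (rcv x c ++ proj c (β ∷ [])) (proj c σ))) (live c))
        y , x⟶y , ctl≡ , w′≡ , r≡ = step⇒edge x w≡ st live₁
        y′ , path , s≈ = run⇒path y (sym ctl≡ , w′≡) run λ c → subst (A.Live c ∘ state c)
                           (trans (split c) (cong (_++ proj c σ) (sym (r≡ c)))) (live c)
    in y′ , x⟶y ◅ path , s≈

  -- Received words grow along cycles that restore the configuration. Only the automaton states they
  -- reach influence the future, so only these are compared.
  Same : Rel Node 0ℓ
  Same x y = _≈_ M (config x) (config y) × (∀ c → states x c ≡ states y c)

  same? : Decidable Same
  same? x y = (ctl x ≟ ctl y ×-dec allFin? (λ c → ≡-dec _≟_ _ _)) ×-dec allFin? (λ c → _ ≟ _)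

  same-next : ∀ {x y x′} → (∀ c → states x c ≡ states y c) →
              ∀ β → (∀ c → rcv x′ c ≡ rcv x c ++ proj c (β ∷ [])) →
              ∀ c → states x′ c ≡ state c (rcv y c ++ proj c (β ∷ []))
  same-next {x} {y} {x′} states≡ β r≡ c = begin
    state c (rcv x′ c)                         ≡⟨ cong (state c) (r≡ c) ⟩
    state c (rcv x c ++ proj c (β ∷ []))       ≡⟨ state-++ c (rcv x c) _ ⟩
    A.δ* c (states x c) (proj c (β ∷ []))      ≡⟨ cong (λ d → A.δ* c d (proj c (β ∷ []))) (states≡ c) ⟩
    A.δ* c (states y c) (proj c (β ∷ []))      ≡⟨ state-++ c (rcv y c) _ ⟨
    state c (rcv y c ++ proj c (β ∷ []))       ∎
    where open ≡-Reasoning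

  same-simulate : ∀ {x y x′} → Same x y → x ⟶ x′ → ∃ λ y′ → y ⟶ y′ × Same x′ y′
  same-simulate {x} {y} {x′} ((refl , w≡) , states≡) x⟶x′
    with β , st , r≡ , live ← edge⇒step x⟶x′
    with y′ , y⟶y′ , ctl≡ , w′≡ , r≡′ ← step⇒edge y w≡ st
           (λ c → subst (A.Live c) (same-next {x} {y} {x′} states≡ β r≡ c) (live c))
    = y′ , y⟶y′ , (sym ctl≡ , w′≡) , λ c → trans (same-next {x} {y} {x′} states≡ β r≡ c) (cong (state c) (sym (r≡′ c)))

  -- Pumping pairs of nodes

  PumpsNode : Rel Node 0ℓ
  PumpsNode x y = ctl x ≡ ctl y × (∀ c → states x c ≡ states y c)
                × (∀ c → A.Pumps c (rcv x c , buf x c) (rcv y c , buf y c))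

  af-pumpsNode : AlmostFull PumpsNode
  af-pumpsNode = af-∩ (af-on ctl af-≡) (af-∩
    (af-∀ λ c → af-on (λ x → states x c) af-≡)
    (af-∀ λ c → af-on (λ x → rcv x c , buf x c)
      (A.af-pumps c (A.loops-commute c (proj₂ (regular c)) (bounded c)))))

  pumps⇒lasso : ∀ {x y y′} → Star _⟶_ root x → x ⟶ y → Star _⟶_ y y′ → PumpsNode x y′ →
                ∃ λ lasso → ∀ c → buf y′ c ≡ buf x c ++ Lasso.z lasso c
  pumps⇒lasso {x} {y} {y′} root⟶*x x⟶y y⟶*y′ (refl , states≡ , pumps) =
    let σ , stem , r≡  = path⇒run root⟶*x
        β , st , r≡₁ , _ = edge⇒step x⟶y
        τ , run , r≡₂ = path⇒run y⟶*y′
        live = target-live x⟶y y⟶*y′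
        received : ∀ c → rcv y′ c ≡ rcv x c ++ proj c (β ∷ τ)
        received c = trans (r≡₂ c) (trans (cong (_++ proj c τ) (r≡₁ c))
          (trans (++-assoc (rcv x c) _ _) (cong (rcv x c ++_) (sym (proj-++ c (β ∷ []) τ)))))
        -- The balance of the whole run between the two nodes is the equation that `Pumps` expects
        -- of the words sent and received.
        pump = λ c → pumps c (live c) (received c) (run-balanced (st ∷ run) c)
    in record
      { stem  = stem
      ; cycle = st ∷ run
      ; z     = λ c → proj₁ (pump c)
      ; grows = λ c → proj₁ (proj₂ (pump c))
      ; phase = λ c → proj₂ (proj₂ (pump c))
      -- Liveness is tested at targets of edges; equality of automaton states carries it from `y′`
      -- back to the end of the stem.
      ; live  = λ c → subst (A.Live c) (trans (sym (states≡ c)) (cong (state c) (r≡ c))) (live c)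
      ; loop  = λ c → begin
          A.δ* c (state c (proj c σ)) (proj c (β ∷ τ))   ≡⟨ cong (λ r → A.δ* c (state c r) (proj c (β ∷ τ))) (r≡ c) ⟨
          A.δ* c (states x c) (proj c (β ∷ τ))           ≡⟨ state-++ c (rcv x c) _ ⟨
          state c (rcv x c ++ proj c (β ∷ τ))            ≡⟨ cong (state c) (received c) ⟨
          states y′ c                                    ≡⟨ states≡ c ⟨
          states x c                                     ≡⟨ cong (state c) (r≡ c) ⟩
          state c (proj c σ)                             ∎
      } , λ c → proj₁ (proj₂ (pump c))
    where open ≡-Reasoning

  -- Deciding termination

  proj-applyUpTo : ∀ c f i {r} → r ≡ proj c (applyUpTo f i) →
                   r ++ proj c (f i ∷ []) ≡ proj c (applyUpTo f (suc i))
  proj-applyUpTo c f i {r} r≡ = begin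
    r ++ proj c (f i ∷ [])                      ≡⟨ cong (_++ proj c (f i ∷ [])) r≡ ⟩
    proj c (applyUpTo f i) ++ proj c (f i ∷ []) ≡⟨ proj-++ c (applyUpTo f i) _ ⟨
    proj c (applyUpTo f i ∷ʳ f i)               ≡⟨ cong (proj c) (applyUpTo-∷ʳ f i) ⟩
    proj c (applyUpTo f (suc i))                ∎
    where open ≡-Reasoning

  -- Each step of the execution is matched by an edge, so the execution would descend for ever
  -- through accessible nodes.
  no-execution : ∀ x → Acc (flip _⟶_) x → (e : InfiniteExecution M Allowed) (i : ℕ) →
    let open InfiniteExecution e using (label) renaming (config to config′) in
    _≈_ M (config′ i) (config x) → ¬ (∀ c → rcv x c ≡ proj c (applyUpTo label i))
  no-execution x (acc rs) e i (refl , w≡) r≡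
    with y , x⟶y , ctl≡ , w′≡ , rcv≡ ← step⇒edge x w≡ (InfiniteExecution.steps e i) (λ c →
           subst (A.Live c ∘ state c) (sym (proj-applyUpTo c (InfiniteExecution.label e) i (r≡ c)))
             (allowed⇒live (applyUpTo (InfiniteExecution.label e) (suc i)) (InfiniteExecution.allowed e (suc i)) c))
    = no-execution y (rs x⟶y) e (suc i) (sym ctl≡ , w′≡)
        λ c → trans (rcv≡ c) (proj-applyUpTo c (InfiniteExecution.label e) i (r≡ c))

  -- Any pumping pair will do, even with every `z` empty, since a cycle without growth is also an
  -- infinite execution.
  lasso-or-halts : Lasso ⊎ Acc (flip _⟶_) root
  lasso-or-halts = halts-or succ af-pumpsNode root
    λ root⟶*x x⟶y y⟶*y′ pumps → proj₁ (pumps⇒lasso root⟶*x x⟶y y⟶*y′ pumps)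

  halts⇒terminating : Acc (flip _⟶_) root → OBTerminating M L
  halts⇒terminating halts e = no-execution root halts e 0
    (subst (λ s → _≈_ M s (initial M)) (sym (InfiniteExecution.starts e)) (refl , λ _ → refl))
    (λ _ → refl)

  terminating? : Dec (OBTerminating M L)
  terminating? = [ (λ lasso → no λ terminating → terminating (lasso⇒execution lasso))
                 , (λ halts → yes (halts⇒terminating halts)) ]′ lasso-or-halts

  -- Deciding unboundedness

  new-pump⇒unbounded : ∀ {x y y′} → Star _⟶_ root x → x ⟶ y → Star _⟶_ y y′ → PumpsNode x y′ →
         ¬ Same y′ x → OBUnbounded M L
  new-pump⇒unbounded {x} {y′ = y′} root⟶*x x⟶y y⟶*y′ pumps@(ctl≡ , states≡ , _) new
    with lasso , buf≡ ← pumps⇒lasso root⟶*x x⟶y y⟶*y′ pumps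
    with anyFin? (λ c → ¬? (≡-dec _≟_ (Lasso.z lasso c) []))
  ... | yes (c , z≢[]) = growing-lasso⇒unbounded lasso c z≢[]
  -- If every `z` were empty, the contents would be unchanged and `y′` would be `Same` as `x`.
  ... | no  none = contradiction
    ((sym ctl≡ , λ c → trans (buf≡ c) (trans (cong (buf x c ++_)
       (decidable-stable (≡-dec _≟_ (Lasso.z lasso c) []) λ z≢[] → none (c , z≢[])))
       (++-identityʳ _))) , λ c → sym (states≡ c)) new

  same-trans : ∀ x y z → Same x y → Same y z → Same x z
  same-trans _ _ _ ((q≡ , w≡) , d≡) ((q≡′ , w≡′) , d≡′) =
    (trans q≡ q≡′ , λ c → trans (w≡ c) (w≡′ c)) , λ c → trans (d≡ c) (d≡′ c)

  Covering : List Node → Set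
  Covering ys = ∀ {x} → Star _⟶_ root x → ∃ λ y → y ∈ ys × Same x y

  -- A cycle without growth says nothing about unboundedness and may keep the tree of all runs
  -- infinite; avoiding repetitions removes such cycles.
  unbounded-or-covered : OBUnbounded M L ⊎ ∃ λ ys → (∀ {y} → y ∈ ys → Star _⟶_ root y) × Covering ys
  unbounded-or-covered =
    Avoiding.cover-or succ same? ((refl , λ _ → refl) , λ _ → refl)
      (λ {x} {y} {z} → same-trans x y z) same-simulate
      af-pumpsNode root new-pump⇒unbounded

  covered⇒finite : ∀ ys → Covering ys → Finite M (Reach M Allowed)
  covered⇒finite ys covering = map config ys , λ s (σ , ok , run) →
    let x , path , q≡ , w≡ = run⇒path root (refl , λ _ → refl) run (allowed⇒live σ ok)
        y , y∈ , (q≡′ , w≡′) , _ = covering path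
    in lose (∈-map⁺ config y∈) (trans q≡ q≡′ , λ c → trans (w≡ c) (w≡′ c))

  unbounded? : Dec (OBUnbounded M L)
  unbounded? = [ yes , (λ (ys , _ , covering) → no λ infinite → infinite (covered⇒finite ys covering)) ]′
    unbounded-or-covered

theorem6p4 : (M : FIFOMachine) → let open FIFOMachine M in
    (L : (c : Channel) → Language (Letter c)) →
    (∀ c → Satisfiable (L c)) →
    (∀ c → Regular (L c)) →
    (∀ c → Bounded (L c)) →
    Dec (OBUnbounded M L) × Dec (OBTerminating M L)
theorem6p4 M L _ regular bounded = unbounded? , terminating?
  where open Decision M L regular bounded
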